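{- There exist an identifiable constraint graph $H$ and a constant $c>0$ such that for all $n\ge 8$, any structure learning algorithm for $H$ and the graph family $\mathcal{G}(n,7)$ that succeeds with probability at least $\exp(-cn)$ requires at least $\exp(cn)$ samples.
   Context: A constraint graph $H$ is an undirected connected graph with vertex set $\{1,\dots,q\}$ (colors), possibly with self-loops, no parallel edges. An $H$-coloring of a graph $G=(V,E)$ is a map $\sigma:V\to V(H)$ with $\{\sigma(v),\sigma(w)\}\in E(H)$ for all $\{v,w\}\in E$; $\Omega_G$ is the set of $H$-colorings and $\pi_G$ the uniform distribution on it. $H$ is identifiable if any two distinct finite $H$-colorable graphs $G_1,G_2$ on the same vertex set satisfy $\pi_{G_1}\neq\pi_{G_2}$. $\mathcal{G}(n,d)$ is the family of graphs on a fixed set of $n$ vertices with maximum degree at most $d$. A structure learning algorithm for $H$ and a family $\mathcal{G}$ of graphs receives $L$ independent samples from $\pi_G$ for an unknown $H$-colorable $G\in\mathcal{G}$ and outputs a graph $\hat G\in\mathcal{G}$; it succeeds with probability at least $p$ if $\Pr[\hat G=G]\ge p$ for every such $G$. The number of samples is $L$. -}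

module Defs where

open import Data.Nat using (ℕ; zero; suc; _*_; _^_; _≤_)
open import Data.Bool using (Bool; true; false; T)
open import Data.Bool.Properties using (T?)
open import Data.Fin using (Fin; zero; suc)
open import Data.Fin.Properties using (all?)
open import Data.List using (List; []; _∷_; [_]; map; concatMap; filter; length; allFin; cartesianProduct)
open import Data.Vec using (Vec; []; _∷_)
open import Data.Product using (Σ; ∃; _×_; _,_; proj₁; proj₂)
open import Data.Integer using (+_)
open import Data.Rational using (ℚ; 0ℚ; _/_)
open import Relation.Nullary using (Dec; yes; no; ¬_)
open import Relation.Nullary.Decidable using (_→-dec_)
open import Relation.Binary.PropositionalEquality using (_≡_)

record Graph (n : ℕ) : Set where
  field
    adj    : Fin n → Fin n → Bool
    sym    : ∀ v w → adj v w ≡ adj w v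
    irrefl : ∀ v → adj v v ≡ false
open Graph public

SameGraph : ∀ {n} → Graph n → Graph n → Set
SameGraph G₁ G₂ = ∀ v w → adj G₁ v w ≡ adj G₂ v w

sameGraph? : ∀ {n} (G₁ G₂ : Graph n) → Dec (SameGraph G₁ G₂)
sameGraph? G₁ G₂ = all? λ v → all? λ w → Data.Bool._≟_ (adj G₁ v w) (adj G₂ v w)
  where import Data.Bool

degree : ∀ {n} → Graph n → Fin n → ℕ
degree {n} G v = length (filter (λ w → T? (adj G v w)) (allFin n))

MaxDegreeAtMost : ∀ {n} → ℕ → Graph n → Set
MaxDegreeAtMost d G = ∀ v → degree G v ≤ d

InFamily : (n d : ℕ) → Graph n → Set
InFamily n d G = MaxDegreeAtMost d G

-- Constraint graphs H on colour set Fin q: undirected, self-loops allowed,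
-- (boolean adjacency, so no parallel edges), connected.

data Reach {q : ℕ} (a : Fin q → Fin q → Bool) : Fin q → Fin q → Set where
  here : ∀ {i} → Reach a i i
  step : ∀ {i j k} → T (a i k) → Reach a k j → Reach a i j

record ConstraintGraph (q : ℕ) : Set where
  field
    hadj      : Fin q → Fin q → Bool
    hsym      : ∀ i j → hadj i j ≡ hadj j i
    nonempty  : Fin q
    connected : ∀ i j → Reach hadj i j
open ConstraintGraph public

Colour : ℕ → ℕ → Set
Colour n q = Fin n → Fin q

IsHColouring : ∀ {n q} → ConstraintGraph q → Graph n → Colour n q → Set
IsHColouring H G σ = ∀ v w → T (adj G v w) → T (hadj H (σ v) (σ w))

isHColouring? : ∀ {n q} (H : ConstraintGraph q) (G : Graph n) (σ : Colour n q) →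
                Dec (IsHColouring H G σ)
isHColouring? H G σ = all? λ v → all? λ w → T? (adj G v w) →-dec T? (hadj H (σ v) (σ w))

HColourable : ∀ {n q} → ConstraintGraph q → Graph n → Set
HColourable H G = ∃ λ σ → IsHColouring H G σ

consF : ∀ {n q} → Fin q → Colour n q → Colour (suc n) q
consF c f zero    = c
consF c f (suc i) = f i

allMaps : (n q : ℕ) → List (Colour n q)
allMaps zero    q = [ (λ ()) ]
allMaps (suc n) q = concatMap (λ c → map (consF c) (allMaps n q)) (allFin q)

-- Ω_G : the list (without repetition) of all H-colourings of G
Ω : ∀ {n q} → ConstraintGraph q → Graph n → List (Colour n q)
Ω {n} {q} H G = filter (isHColouring? H G) (allMaps n q)

-- π_G : the uniform distribution on Ω_G, as a probability mass function
-- (only meaningful when G is H-colourable; it is 0 everywhere otherwise)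
π : ∀ {n q} → ConstraintGraph q → Graph n → Colour n q → ℚ
π H G σ with length (Ω H G) | isHColouring? H G σ
... | zero  | _     = 0ℚ
... | suc k | yes _ = (+ 1) / suc k
... | suc k | no _  = 0ℚ

Identifiable : ∀ {q} → ConstraintGraph q → Set
Identifiable {q} H = ∀ (n : ℕ) (G₁ G₂ : Graph n) →
  HColourable H G₁ → HColourable H G₂ → ¬ SameGraph G₁ G₂ →
  ¬ (∀ (σ : Colour n q) → π H G₁ σ ≡ π H G₂ σ)

-- Structure learning algorithms (possibly randomised with a uniform seed
-- from Fin (suc s)), taking L samples and outputting a graph in 𝒢(n,d).

Algorithm : (n q L s : ℕ) → Set
Algorithm n q L s = Vec (Colour n q) L → Fin (suc s) → Graph n

OutputsInFamily : ∀ {n q L s} → ℕ → Algorithm n q L s → Set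
OutputsInFamily {n} d A = ∀ x r → InFamily n d (A x r)

tuples : ∀ {A : Set} → List A → (L : ℕ) → List (Vec A L)
tuples xs zero    = [ [] ]
tuples xs (suc L) = concatMap (λ x → map (x ∷_) (tuples xs L)) xs

-- number of (sample tuple, seed) pairs on which A outputs exactly G, when the
-- L samples are drawn i.i.d. from π_G
successCount : ∀ {n q L s} → ConstraintGraph q → Algorithm n q L s → Graph n → ℕ
successCount {L = L} {s} H A G =
  length (filter (λ p → sameGraph? (A (proj₁ p) (proj₂ p)) G)
                 (cartesianProduct (tuples (Ω H G) L) (allFin (suc s))))

-- total number of equally likely outcomes: |Ω_G|^L · (s+1)
totalCount : ∀ {n q} → ConstraintGraph q → Graph n → (L s : ℕ) → ℕ
totalCount H G L s = length (Ω H G) ^ L * suc s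

-- Pr[Ĝ = G] ≥ (b/a)^n  ⟺  successCount · a^n ≥ totalCount · b^n
SucceedsWithProb≥ : ∀ {n q L s} → ConstraintGraph q → ℕ → Algorithm n q L s →
                    (a b : ℕ) → Set
SucceedsWithProb≥ {n} {L = L} {s} H d A a b =
  ∀ (G : Graph n) → InFamily n d G → HColourable H G →
    totalCount H G L s * b ^ n ≤ successCount H A G * a ^ n

{-# OPTIONS --safe #-}

-- H consists of a hard-core part (a looped colour and a loopless neighbour of it) and a complete tripartite
-- part with four colours in each class, joined through edges that lie in no triangle.  The hard-core part makes
-- H identifiable: two non-adjacent vertices can both receive the loopless colour.  In the square of a path,
-- where i is joined to i + 1 and i + 2, every edge lies in a triangle, so a colouring stays inside one of the
-- two parts; inside the tripartite part the class of i depends only on i mod 3, so any chords i — i + 4 may be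
-- added without excluding a tripartite colouring.  The 2 ^ (n - 4) chorded graphs thus share at least 4 ^ n
-- colourings, while each has at most 2 ^ n others: subexponentially many samples are very likely to lie all
-- in the common set, and there each output is correct for at most one of the graphs.
module Submission where

open import Defs
import Algebra.Properties.CommutativeSemigroup as CommutativeSemigroupProperties
open import Data.Bool using (Bool; true; false; T; if_then_else_)
import Data.Bool as Bool
open import Data.Bool.Properties using (T?)
open import Data.Empty using (⊥; ⊥-elim)
open import Data.Fin using (Fin; zero; suc; toℕ; fromℕ<; inject≤; #_)
open import Data.Fin.Patterns using (0F; 1F; 2F; 3F; 4F; 6F)
open import Data.Fin.Properties using (all?; any?; toℕ-fromℕ<; fromℕ<-toℕ; toℕ-inject≤; toℕ<n)
import Data.Fin.Properties as Fin
open import Data.List using (List; []; _∷_; _++_; map; concatMap; filter; length; allFin; cartesianProduct)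
open import Data.List.Membership.Propositional using (_∈_)
open import Data.List.Properties using (map-++; map-∘; map-tabulate; length-tabulate)
open import Data.List.Relation.Unary.Any using (here; there)
open import Data.Nat using (ℕ; zero; suc; _+_; _*_; _∸_; _^_; _≤_; _<_; _⊓_; ∣_-_∣; z≤n; s≤s; _≟_; _≤?_; NonZero; >-nonZero)
open import Data.Nat.ListAction using (sum)
open import Data.Nat.ListAction.Properties using (sum-++)
open import Data.Nat.Properties hiding (_≟_; _≤?_)
open import Data.Nat.Tactic.RingSolver using (solve-∀)
open import Data.Product using (Σ; ∃; _×_; _,_; proj₁; proj₂)
open import Data.Rational using (0ℚ; Positive)
open import Data.Rational.Properties using (normalize-pos)
open import Data.Sum using (_⊎_; inj₁; inj₂; [_,_]′)
open import Data.Unit using (tt)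
open import Data.Vec using (Vec; []; _∷_; lookup; tabulate)
open import Data.Vec.Properties using (tabulate∘lookup; tabulate-cong)
open import Function using (_∘_)
open import Relation.Binary.PropositionalEquality as ≡ using (_≡_; _≢_; refl; cong; cong₂; trans; subst; subst₂)
open import Relation.Nullary using (Dec; yes; no; ¬_; does; _×-dec_; ¬?)
open import Relation.Nullary.Decidable using (from-yes; toWitness; _→-dec_)
open import Relation.Unary using (Decidable)

open CommutativeSemigroupProperties +-commutativeSemigroup using () renaming (x∙yz≈y∙xz to +-swap; interchange to +-interchange)
open CommutativeSemigroupProperties *-commutativeSemigroup using () renaming (x∙yz≈y∙xz to *-swap)

private variable
  A B P Q R : Set
  m n q : ℕ

-- Arithmetic of powers and ratios.

^-distribʳ-* : ∀ n a b → (a * b) ^ n ≡ a ^ n * b ^ n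
^-distribʳ-* zero    a b = refl
^-distribʳ-* (suc n) a b = trans (cong (a * b *_) (^-distribʳ-* n a b)) ([m*n]*[o*p]≡[m*o]*[n*p] a b (a ^ n) (b ^ n))

-- Each further factor multiplies the left side by `x` and the right side by the larger `y`, so one
-- numerical check at exponent `n` settles all later exponents.
*-^-mono : ∀ c {x y} → x ≤ y → ∀ n → c * x ^ n ≤ y ^ n → ∀ k → c * x ^ (k + n) ≤ y ^ (k + n)
*-^-mono c         x≤y n base zero    = base
*-^-mono c {x} {y} x≤y n base (suc k) = begin
  c * (x * x ^ (k + n))   ≡⟨ *-swap c x (x ^ (k + n)) ⟩
  x * (c * x ^ (k + n))   ≤⟨ *-mono-≤ x≤y (*-^-mono c x≤y n base k) ⟩
  y * y ^ (k + n)         ∎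
  where open ≤-Reasoning

-- Plays a guaranteed success ratio `y / z` against an upper bound `c / x` on the same ratio, with
-- all denominators cleared.
cancel-total : ∀ total .{{_ : NonZero total}} success x y z c →
               total * y ≤ success * z → x * success ≤ total * c → x * y ≤ c * z
cancel-total total success x y z c lower upper = *-cancelˡ-≤ total (begin
  total * (x * y)     ≡⟨ *-swap total x y ⟩
  x * (total * y)     ≤⟨ *-monoʳ-≤ x lower ⟩
  x * (success * z)   ≡⟨ *-assoc x success z ⟨
  x * success * z     ≤⟨ *-monoˡ-≤ z upper ⟩
  total * c * z       ≡⟨ *-assoc total c z ⟩
  total * (c * z)     ∎)
  where open ≤-Reasoning

-- Finite sums and counting

∑ : List A → (A → ℕ) → ℕ
∑ xs f = sum (map f xs)

∑-++ : ∀ (xs ys : List A) f → ∑ (xs ++ ys) f ≡ ∑ xs f + ∑ ys f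
∑-++ xs ys f = trans (cong sum (map-++ f xs ys)) (sum-++ (map f xs) (map f ys))

∑-map : ∀ (g : A → B) xs f → ∑ (map g xs) f ≡ ∑ xs (f ∘ g)
∑-map g xs f = cong sum (≡.sym (map-∘ xs))

∑-cong : ∀ (xs : List A) {f g} → (∀ x → f x ≡ g x) → ∑ xs f ≡ ∑ xs g
∑-cong []       eq = refl
∑-cong (x ∷ xs) eq = cong₂ _+_ (eq x) (∑-cong xs eq)

∑-mono : ∀ (xs : List A) {f g} → (∀ x → f x ≤ g x) → ∑ xs f ≤ ∑ xs g
∑-mono []       le = z≤n
∑-mono (x ∷ xs) le = +-mono-≤ (le x) (∑-mono xs le)

∑-const : ∀ (xs : List A) k → ∑ xs (λ _ → k) ≡ length xs * k
∑-const []       k = refl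
∑-const (x ∷ xs) k = cong (k +_) (∑-const xs k)

∑-zero : ∀ (xs : List A) → ∑ xs (λ _ → 0) ≡ 0
∑-zero xs = trans (∑-const xs 0) (*-zeroʳ (length xs))

∑-+ : ∀ (xs : List A) f g → ∑ xs (λ x → f x + g x) ≡ ∑ xs f + ∑ xs g
∑-+ []       f g = refl
∑-+ (x ∷ xs) f g = trans (cong (f x + g x +_) (∑-+ xs f g)) (+-interchange (f x) (g x) (∑ xs f) (∑ xs g))

∑-*ˡ : ∀ k (xs : List A) f → ∑ xs (λ x → k * f x) ≡ k * ∑ xs f
∑-*ˡ k []       f = ≡.sym (*-zeroʳ k)
∑-*ˡ k (x ∷ xs) f = trans (cong (k * f x +_) (∑-*ˡ k xs f)) (≡.sym (*-distribˡ-+ k (f x) (∑ xs f)))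

∑-swap : ∀ (xs : List A) (ys : List B) (f : A → B → ℕ) → ∑ xs (λ x → ∑ ys (f x)) ≡ ∑ ys (λ y → ∑ xs (λ x → f x y))
∑-swap []       ys f = ≡.sym (∑-zero ys)
∑-swap (x ∷ xs) ys f = trans (cong (∑ ys (f x) +_) (∑-swap xs ys f)) (≡.sym (∑-+ ys (f x) _))

∑-concatMap : ∀ (g : A → List B) xs f → ∑ (concatMap g xs) f ≡ ∑ xs (λ x → ∑ (g x) f)
∑-concatMap g []       f = refl
∑-concatMap g (x ∷ xs) f = trans (∑-++ (g x) (concatMap g xs) f) (cong (∑ (g x) f +_) (∑-concatMap g xs f))

∑-cartesianProduct : ∀ (xs : List A) (ys : List B) f →
                     ∑ (cartesianProduct xs ys) f ≡ ∑ xs (λ x → ∑ ys (λ y → f (x , y)))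
∑-cartesianProduct []       ys f = refl
∑-cartesianProduct (x ∷ xs) ys f =
  trans (∑-++ (map (x ,_) ys) _ f) (cong₂ _+_ (∑-map (x ,_) ys f) (∑-cartesianProduct xs ys f))

∑-tuples : ∀ (xs : List A) L f → ∑ (tuples xs (suc L)) f ≡ ∑ xs (λ x → ∑ (tuples xs L) (f ∘ (x ∷_)))
∑-tuples xs L f = trans (∑-concatMap _ xs f) (∑-cong xs λ x → ∑-map (x ∷_) (tuples xs L) f)

∑-allMaps : ∀ n q f → ∑ (allMaps (suc n) q) f ≡ ∑ (allFin q) (λ c → ∑ (allMaps n q) (f ∘ consF c))
∑-allMaps n q f = trans (∑-concatMap _ (allFin q) f) (∑-cong (allFin q) λ c → ∑-map (consF c) (allMaps n q) f)

-- Keeping the smaller of the head and the inductive witness finds a minimiser, and a minimum is at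
-- most the average.
below-average : ∀ (xs : List A) → 0 < length xs → ∀ f → ∃ λ x → length xs * f x ≤ ∑ xs f
below-average (x ∷ [])         _ f = x , ≤-refl
below-average (x ∷ xs@(_ ∷ _)) _ f with below-average xs (s≤s z≤n) f
... | y , le with f x ≤? f y
...   | yes x≤y = x , +-monoʳ-≤ (f x) (≤-trans (*-monoʳ-≤ (length xs) x≤y) le)
...   | no  x≰y = y , +-mono-≤ (<⇒≤ (≰⇒> x≰y)) le

length-∑ : ∀ (xs : List A) → length xs ≡ ∑ xs (λ _ → 1)
length-∑ xs = ≡.sym (trans (∑-const xs 1) (*-identityʳ _))

-- The hypothesis says that `W` is the multiset union of `D` and `C`, tested against every weight
-- `f`; the constant weight 1 gives lengths.
length-≤-split : ∀ {W D C : List A} → (∀ f → ∑ W f ≡ ∑ D f + ∑ C f) → length D ≤ length W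
length-≤-split {W = W} {D} {C} split = ≤-trans (m≤m+n (length D) (length C)) (≤-reflexive
  (trans (cong₂ _+_ (length-∑ D) (length-∑ C)) (trans (≡.sym (split _)) (≡.sym (length-∑ W)))))

length-tuples : ∀ (xs : List A) L → length (tuples xs L) ≡ length xs ^ L
length-tuples xs zero    = refl
length-tuples xs (suc L) = begin
  length (tuples xs (suc L))            ≡⟨ length-∑ (tuples xs (suc L)) ⟩
  ∑ (tuples xs (suc L)) (λ _ → 1)       ≡⟨ ∑-tuples xs L _ ⟩
  ∑ xs (λ _ → ∑ (tuples xs L) λ _ → 1)  ≡⟨ ∑-cong xs (λ _ → ≡.sym (length-∑ (tuples xs L))) ⟩
  ∑ xs (λ _ → length (tuples xs L))     ≡⟨ ∑-const xs _ ⟩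
  length xs * length (tuples xs L)      ≡⟨ cong (length xs *_) (length-tuples xs L) ⟩
  length xs * length xs ^ L             ∎
  where open ≡.≡-Reasoning

𝟙 : Dec P → ℕ
𝟙 P? = if does P? then 1 else 0

𝟙-≤1 : (P? : Dec P) → 𝟙 P? ≤ 1
𝟙-≤1 (yes _) = ≤-refl
𝟙-≤1 (no  _) = z≤n

𝟙-mono : (P? : Dec P) (Q? : Dec Q) → (P → Q) → 𝟙 P? ≤ 𝟙 Q?
𝟙-mono (no  _) _       _ = z≤n
𝟙-mono (yes x) (yes _) _ = ≤-refl
𝟙-mono (yes x) (no ¬y) f = ⊥-elim (¬y (f x))

𝟙-no : (P? : Dec P) → ¬ P → 𝟙 P? ≡ 0
𝟙-no (yes x) ¬x = ⊥-elim (¬x x)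
𝟙-no (no  _) _  = refl

𝟙-yes : (P? : Dec P) → P → 1 ≤ 𝟙 P?
𝟙-yes (yes _) _ = ≤-refl
𝟙-yes (no ¬x) x = ⊥-elim (¬x x)

𝟙-× : (R? : Dec R) (P? : Dec P) (Q? : Dec Q) → (R → P × Q) → (P × Q → R) → 𝟙 R? ≡ 𝟙 P? * 𝟙 Q?
𝟙-× (yes r) (yes _) (yes _) f g = refl
𝟙-× (yes r) (no ¬x) _       f g = ⊥-elim (¬x (proj₁ (f r)))
𝟙-× (yes r) (yes _) (no ¬y) f g = ⊥-elim (¬y (proj₂ (f r)))
𝟙-× (no ¬r) (yes x) (yes y) f g = ⊥-elim (¬r (g (x , y)))
𝟙-× (no _)  (yes _) (no _)  f g = refl
𝟙-× (no _)  (no _)  _       f g = refl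

length-filter-∑ : ∀ {P : A → Set} (P? : Decidable P) xs → length (filter P? xs) ≡ ∑ xs (λ x → 𝟙 (P? x))
length-filter-∑ P? []       = refl
length-filter-∑ P? (x ∷ xs) with P? x
... | yes _ = cong suc (length-filter-∑ P? xs)
... | no  _ = length-filter-∑ P? xs

∑-filter-split : ∀ {P Q : A → Set} (P? : Decidable P) (Q? : Decidable Q) → (∀ x → Q x → P x) → ∀ xs f →
                 ∑ (filter P? xs) f ≡ ∑ (filter Q? xs) f + ∑ (filter (λ x → P? x ×-dec ¬? (Q? x)) xs) f
∑-filter-split P? Q? Q⊆P []       f = refl
∑-filter-split P? Q? Q⊆P (x ∷ xs) f with P? x | Q? x
... | yes _ | yes _ = trans (cong (f x +_) (∑-filter-split P? Q? Q⊆P xs f)) (≡.sym (+-assoc (f x) _ _))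
... | yes _ | no  _ = trans (cong (f x +_) (∑-filter-split P? Q? Q⊆P xs f)) (+-swap (f x) (∑ (filter Q? xs) f) _)
... | no ¬p | yes q = ⊥-elim (¬p (Q⊆P x q))
... | no  _ | no  _ = ∑-filter-split P? Q? Q⊆P xs f

∑-allFin-suc : ∀ n f → ∑ (allFin (suc n)) f ≡ f zero + ∑ (allFin n) (f ∘ suc)
∑-allFin-suc n f = cong (f zero +_) (trans (cong (λ zs → ∑ zs f) (≡.sym (map-tabulate (λ i → i) suc))) (∑-map suc (allFin n) f))

∑-indicator≤1 : ∀ n k → ∑ (allFin n) (λ i → 𝟙 (toℕ i ≟ k)) ≤ 1
∑-indicator≤1 zero    k = z≤n
∑-indicator≤1 (suc n) zero = ≤-reflexive (trans (∑-allFin-suc n (λ i → 𝟙 (toℕ i ≟ 0))) (cong suc (∑-zero (allFin n))))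
∑-indicator≤1 (suc n) (suc k) = ≤-trans (≤-reflexive (∑-allFin-suc n (λ i → 𝟙 (toℕ i ≟ suc k)))) (∑-indicator≤1 n k)

member≤∑ : ∀ k ks → k ∈ ks → 1 ≤ ∑ ks (λ j → 𝟙 (k ≟ j))
member≤∑ k (j ∷ ks) (there k∈ks) = ≤-trans (member≤∑ k ks k∈ks) (m≤n+m _ _)
member≤∑ k (k ∷ ks) (here refl) = ≤-trans (𝟙-yes (k ≟ k) refl) (m≤m+n _ _)

-- Double counting: every number in `ks` is the value of at most one index. Repetitions in `ks` only
-- weaken the bound.
length-filter-allFin : ∀ {n} {P : Fin n → Set} (P? : Decidable P) ks →
                       (∀ i → P i → toℕ i ∈ ks) → length (filter P? (allFin n)) ≤ length ks
length-filter-allFin {n} P? ks P⊆ks = begin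
  length (filter P? (allFin n))                      ≡⟨ length-filter-∑ P? (allFin n) ⟩
  ∑ (allFin n) (λ i → 𝟙 (P? i))                      ≤⟨ ∑-mono (allFin n) bound ⟩
  ∑ (allFin n) (λ i → ∑ ks (λ k → 𝟙 (toℕ i ≟ k)))    ≡⟨ ∑-swap (allFin n) ks (λ i k → 𝟙 (toℕ i ≟ k)) ⟩
  ∑ ks (λ k → ∑ (allFin n) (λ i → 𝟙 (toℕ i ≟ k)))    ≤⟨ ∑-mono ks (∑-indicator≤1 n) ⟩
  ∑ ks (λ _ → 1)                                     ≡⟨ ≡.sym (length-∑ ks) ⟩
  length ks                                          ∎
  where
  open ≤-Reasoning
  bound : ∀ i → 𝟙 (P? i) ≤ ∑ ks (λ k → 𝟙 (toℕ i ≟ k))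
  bound i with P? i
  ... | yes x = member≤∑ (toℕ i) ks (P⊆ks i x)
  ... | no  _ = z≤n

-- The constraints on different coordinates are independent, so the first coordinate splits off as a
-- factor `k`.
count-product : ∀ n {q} {P : Fin n → Fin q → Set} (P? : ∀ i → Decidable (P i)) k →
                (∀ i → ∑ (allFin q) (λ c → 𝟙 (P? i c)) ≡ k) →
                ∑ (allMaps n q) (λ σ → 𝟙 (all? (λ i → P? i (σ i)))) ≡ k ^ n
count-product zero    P? k eq = refl
count-product (suc n) {q} {P} P? k eq = begin
  ∑ (allMaps (suc n) q) (λ σ → 𝟙 (all? (λ i → P? i (σ i))))
    ≡⟨ ∑-allMaps n q _ ⟩
  ∑ (allFin q) (λ c → ∑ (allMaps n q) (λ σ → 𝟙 (all? (λ i → P? i (consF c σ i)))))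
    ≡⟨ ∑-cong (allFin q) (λ c → ∑-cong (allMaps n q) (factor c)) ⟩
  ∑ (allFin q) (λ c → ∑ (allMaps n q) (λ σ → 𝟙 (P? zero c) * 𝟙 (all? (λ i → P? (suc i) (σ i)))))
    ≡⟨ ∑-cong (allFin q) (λ c → trans (∑-*ˡ (𝟙 (P? zero c)) (allMaps n q) _)
         (trans (cong (𝟙 (P? zero c) *_) (count-product n (P? ∘ suc) k (eq ∘ suc))) (*-comm (𝟙 (P? zero c)) (k ^ n)))) ⟩
  ∑ (allFin q) (λ c → k ^ n * 𝟙 (P? zero c))
    ≡⟨ ∑-*ˡ (k ^ n) (allFin q) _ ⟩
  k ^ n * ∑ (allFin q) (λ c → 𝟙 (P? zero c))
    ≡⟨ cong (k ^ n *_) (eq zero) ⟩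
  k ^ n * k
    ≡⟨ *-comm (k ^ n) k ⟩
  k * k ^ n ∎
  where
  open ≡.≡-Reasoning
  factor : ∀ c σ → 𝟙 (all? (λ i → P? i (consF c σ i))) ≡ 𝟙 (P? zero c) * 𝟙 (all? (λ i → P? (suc i) (σ i)))
  factor c σ = 𝟙-× (all? (λ i → P? i (consF c σ i))) (P? zero c) (all? (λ i → P? (suc i) (σ i)))
    (λ h → h zero , λ i → h (suc i)) (λ { (h , t) zero → h ; (h , t) (suc i) → t i })

-- Every Boolean vector is listed exactly once. Splitting on the first bit, the half that disagrees
-- with `γ` contributes nothing.
∑-boolVecs-≤1 : ∀ m (f : Vec Bool m → ℕ) γ → (∀ β → f β ≤ 1) → (∀ β → β ≢ γ → f β ≡ 0) →
                ∑ (tuples (false ∷ true ∷ []) m) f ≤ 1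
∑-boolVecs-≤1 zero    f γ f≤1 f≡0 = ≤-trans (≤-reflexive (+-identityʳ (f []))) (f≤1 [])
∑-boolVecs-≤1 (suc m) f (b ∷ γ) f≤1 f≡0 = ≤-trans (≤-reflexive (∑-tuples _ m f)) (halves b f≡0)
  where
  tails = tuples (false ∷ true ∷ []) m
  none : ∀ c → (∀ β → f (c ∷ β) ≡ 0) → ∑ tails (f ∘ (c ∷_)) ≡ 0
  none c eq = trans (∑-cong tails eq) (∑-zero tails)
  ∷-tail : ∀ {c : Bool} {β} → c ∷ β ≡ c ∷ γ → β ≡ γ
  ∷-tail refl = refl
  some : ∀ c → (∀ β → β ≢ c ∷ γ → f β ≡ 0) → ∑ tails (f ∘ (c ∷_)) ≤ 1
  some c eq = ∑-boolVecs-≤1 m (f ∘ (c ∷_)) γ (f≤1 ∘ (c ∷_)) (λ β β≢γ → eq (c ∷ β) (β≢γ ∘ ∷-tail))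
  halves : ∀ b → (∀ β → β ≢ b ∷ γ → f β ≡ 0) →
           ∑ tails (f ∘ (false ∷_)) + (∑ tails (f ∘ (true ∷_)) + 0) ≤ 1
  halves false eq rewrite none true (λ β → eq (true ∷ β) λ ()) | +-identityʳ (∑ tails (f ∘ (false ∷_))) = some false eq
  halves true  eq rewrite none false (λ β → eq (false ∷ β) λ ()) | +-identityʳ (∑ tails (f ∘ (true ∷_))) = some true eq

-- Union bound: each of the L samples leaves D with probability at most 1 / m.
∑-tuples-≤ : ∀ {W D C : List A} m → (∀ f → ∑ W f ≡ ∑ D f + ∑ C f) → m * length C ≤ length D →
             ∀ K L (f : Vec A L → ℕ) → (∀ t → f t ≤ K) →
             m * ∑ (tuples W L) f ≤ m * ∑ (tuples D L) f + K * (L * length W ^ L)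
∑-tuples-≤ m split mC≤D K zero    f f≤K = m≤m+n _ _
∑-tuples-≤ {W = W} {D} {C} m split mC≤D K (suc L) f f≤K = begin
  m * ∑ (tuples W (suc L)) f
    ≡⟨ cong (m *_) (trans (∑-tuples W L f) (split F)) ⟩
  m * (∑ D F + ∑ C F)
    ≡⟨ *-distribˡ-+ m (∑ D F) (∑ C F) ⟩
  m * ∑ D F + m * ∑ C F
    ≡⟨ cong (_+ m * ∑ C F) (≡.sym (∑-*ˡ m D F)) ⟩
  ∑ D (λ x → m * F x) + m * ∑ C F
    -- If the first sample lies in `D`, the induction hypothesis treats the others; if it lies in
    -- `C`, every value of `f` is bounded by `K`.
    ≤⟨ +-mono-≤ (∑-mono D λ x → ∑-tuples-≤ {W = W} {D} {C} m split mC≤D K L (f ∘ (x ∷_)) (f≤K ∘ (x ∷_)))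
                (*-monoʳ-≤ m (≤-trans (∑-mono C F≤) (≤-reflexive (∑-const C (w ^ L * K))))) ⟩
  ∑ D (λ x → m * F′ x + K * (L * w ^ L)) + m * (c * (w ^ L * K))
    ≡⟨ cong (_+ m * (c * (w ^ L * K))) (trans (∑-+ D _ _) (cong₂ _+_ (∑-*ˡ m D F′) (∑-const D _))) ⟩
  m * ∑ D F′ + d * (K * (L * w ^ L)) + m * (c * (w ^ L * K))
    ≡⟨ rearrange (m * ∑ D F′) d K L (w ^ L) m c ⟩
  m * ∑ D F′ + (d * (K * (L * w ^ L)) + m * c * (w ^ L * K))
    ≤⟨ +-monoʳ-≤ (m * ∑ D F′) (+-mono-≤ (*-monoˡ-≤ (K * (L * w ^ L)) d≤w) (*-monoˡ-≤ (w ^ L * K) (≤-trans mC≤D d≤w))) ⟩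
  m * ∑ D F′ + (w * (K * (L * w ^ L)) + w * (w ^ L * K))
    ≡⟨ cong₂ _+_ (cong (m *_) (≡.sym (∑-tuples D L f))) (collect w K L (w ^ L)) ⟩
  m * ∑ (tuples D (suc L)) f + K * (suc L * w ^ suc L) ∎
  where
  open ≤-Reasoning
  w = length W
  d = length D
  c = length C
  F F′ : _ → ℕ
  F x  = ∑ (tuples W L) (f ∘ (x ∷_))
  F′ x = ∑ (tuples D L) (f ∘ (x ∷_))
  F≤ : ∀ x → F x ≤ w ^ L * K
  F≤ x = ≤-trans (∑-mono (tuples W L) (f≤K ∘ (x ∷_)))
           (≤-reflexive (trans (∑-const (tuples W L) K) (cong (_* K) (length-tuples W L))))
  d≤w = length-≤-split {W = W} {D} {C} split
  rearrange : ∀ s d K L v m c → s + d * (K * (L * v)) + m * (c * (v * K)) ≡ s + (d * (K * (L * v)) + m * c * (v * K))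
  rearrange = solve-∀
  collect : ∀ w K L v → w * (K * (L * v)) + w * (v * K) ≡ K * ((1 + L) * (w * v))
  collect = solve-∀

-- Counting colourings, and identifiability from a hard-core pair of colours.

k^n≤length-Ω : ∀ (H : ConstraintGraph q) (G : Graph n) {P : Fin n → Fin q → Set} (P? : ∀ i → Decidable (P i)) k →
               (∀ i → ∑ (allFin q) (λ c → 𝟙 (P? i c)) ≡ k) →
               (∀ σ → (∀ i → P i (σ i)) → IsHColouring H G σ) → k ^ n ≤ length (Ω H G)
k^n≤length-Ω {q} {n} H G P? k count P⇒col = begin
  k ^ n                                                   ≡⟨ count-product n P? k count ⟨
  ∑ (allMaps n q) (λ σ → 𝟙 (all? (λ i → P? i (σ i))))     ≤⟨ ∑-mono (allMaps n q) (λ σ → 𝟙-mono (all? (λ i → P? i (σ i))) (isHColouring? H G σ) (P⇒col σ)) ⟩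
  ∑ (allMaps n q) (λ σ → 𝟙 (isHColouring? H G σ))         ≡⟨ length-filter-∑ (isHColouring? H G) (allMaps n q) ⟨
  length (Ω H G)                                          ∎
  where open ≤-Reasoning

π-outside : ∀ (H : ConstraintGraph q) (G : Graph n) σ → ¬ IsHColouring H G σ → π H G σ ≡ 0ℚ
π-outside H G σ ¬col with length (Ω H G) | isHColouring? H G σ
... | zero  | _       = refl
... | suc k | yes col = ⊥-elim (¬col col)
... | suc k | no _    = refl

π-inside : ∀ (H : ConstraintGraph q) (G : Graph n) σ → 1 ≤ length (Ω H G) → IsHColouring H G σ → π H G σ ≢ 0ℚ
π-inside H G σ 1≤Ω col with length (Ω H G) | isHColouring? H G σ
... | suc k | yes _   = λ eq → 0-not-positive (subst Positive eq (normalize-pos 1 (suc k)))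
  where
  0-not-positive : ¬ Positive 0ℚ
  0-not-positive ()
... | suc k | no ¬col = ⊥-elim (¬col col)

module HardCore (H : ConstraintGraph q) (free occ : Fin q)
  (free-free : T (hadj H free free)) (free-occ : T (hadj H free occ)) (occ-occ : ¬ T (hadj H occ occ)) where

  occ-free : T (hadj H occ free)
  occ-free = subst T (hsym H free occ) free-occ

  1≤length-Ω : (G : Graph n) → 1 ≤ length (Ω H G)
  1≤length-Ω {n} G = subst (_≤ length (Ω H G)) (^-zeroˡ n)
    (k^n≤length-Ω H G (λ _ c → c Fin.≟ free) 1 (λ _ → count free)
      (λ σ eq v w _ → subst₂ (λ c d → T (hadj H c d)) (≡.sym (eq v)) (≡.sym (eq w)) free-free))
    where
    count : ∀ {q} (c : Fin q) → ∑ (allFin q) (λ d → 𝟙 (d Fin.≟ c)) ≡ 1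
    count {suc q} zero    = trans (∑-allFin-suc q (λ d → 𝟙 (d Fin.≟ zero))) (cong suc (∑-zero (allFin q)))
    count {suc q} (suc c) = trans (∑-allFin-suc q (λ d → 𝟙 (d Fin.≟ suc c))) (count c)

  module _ {n : ℕ} (v w : Fin n) where
    Occupied : Fin n → Set
    Occupied u = u ≡ v ⊎ u ≡ w

    pair : Colour n q
    pair u with u Fin.≟ v | u Fin.≟ w
    ... | yes _ | _     = occ
    ... | no  _ | yes _ = occ
    ... | no  _ | no  _ = free

    pair-cases : ∀ u → (Occupied u × pair u ≡ occ) ⊎ (pair u ≡ free)
    pair-cases u with u Fin.≟ v | u Fin.≟ w
    ... | yes p | _     = inj₁ (inj₁ p , refl)
    ... | no  _ | yes p = inj₁ (inj₂ p , refl)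
    ... | no  _ | no  _ = inj₂ refl

    pair-v : pair v ≡ occ
    pair-v with v Fin.≟ v
    ... | yes _ = refl
    ... | no v≢v = ⊥-elim (v≢v refl)

    pair-w : pair w ≡ occ
    pair-w with w Fin.≟ v | w Fin.≟ w
    ... | yes _ | _     = refl
    ... | no  _ | yes _ = refl
    ... | no  _ | no w≢w = ⊥-elim (w≢w refl)

    independent : (G : Graph n) → adj G v w ≡ false → ∀ x y → Occupied x → Occupied y → ¬ T (adj G x y)
    independent G vw x y (inj₁ refl) (inj₁ refl) = subst T (irrefl G v)
    independent G vw x y (inj₁ refl) (inj₂ refl) = subst T vw
    independent G vw x y (inj₂ refl) (inj₁ refl) = subst T (trans (sym G w v) vw)
    independent G vw x y (inj₂ refl) (inj₂ refl) = subst T (irrefl G w)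

    pair-colours : (G : Graph n) → adj G v w ≡ false → IsHColouring H G pair
    pair-colours G vw x y xy with pair-cases x | pair-cases y
    ... | inj₁ (ox , _) | inj₁ (oy , _) = ⊥-elim (independent G vw x y ox oy xy)
    ... | inj₁ (_ , px) | inj₂ py = subst₂ (λ c d → T (hadj H c d)) (≡.sym px) (≡.sym py) occ-free
    ... | inj₂ px | inj₁ (_ , py) = subst₂ (λ c d → T (hadj H c d)) (≡.sym px) (≡.sym py) free-occ
    ... | inj₂ px | inj₂ py = subst₂ (λ c d → T (hadj H c d)) (≡.sym px) (≡.sym py) free-free

    pair-fails : (G : Graph n) → adj G v w ≡ true → ¬ IsHColouring H G pair
    pair-fails G vw col = occ-occ (subst₂ (λ c d → T (hadj H c d)) pair-v pair-w
                                    (col v w (subst T (≡.sym vw) tt)))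

  -- The supports alone separate the graphs. If exactly one of them joins `v` and `w`, then
  -- `pair v w` has probability zero there and positive probability in the other, whose colouring
  -- set is nonempty.
  identifiable : Identifiable H
  identifiable n G₁ G₂ _ _ G₁≢G₂ π₁≡π₂ = G₁≢G₂ same
    where
    clash : ∀ (G G′ : Graph n) → (∀ σ → π H G σ ≡ π H G′ σ) → ∀ v w → adj G v w ≡ true → adj G′ v w ≡ false → ⊥
    clash G G′ eq v w e e′ = π-inside H G′ (pair v w) (1≤length-Ω G′) (pair-colours v w G′ e′)
      (trans (≡.sym (eq (pair v w))) (π-outside H G (pair v w) (pair-fails v w G e)))
    same : SameGraph G₁ G₂
    same v w with adj G₁ v w in e₁ | adj G₂ v w in e₂
    ... | true  | true  = refl
    ... | false | false = refl
    ... | true  | false = ⊥-elim (clash G₁ G₂ π₁≡π₂ v w e₁ e₂)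
    ... | false | true  = ⊥-elim (clash G₂ G₁ (λ σ → ≡.sym (π₁≡π₂ σ)) v w e₂ e₁)

-- Learning a family of graphs with a large common set D of colourings

-- The conditional success probability given the samples `t`, scaled by the number of seeds; this
-- reduces a randomised algorithm to a weight on sample tuples.
votes : ∀ {L s} → Algorithm n q L s → Graph n → Vec (Colour n q) L → ℕ
votes {s = s} A G t = ∑ (allFin (suc s)) (λ r → 𝟙 (sameGraph? (A t r) G))

∑-seeds : ∀ s → ∑ (allFin (suc s)) (λ _ → 1) ≡ suc s
∑-seeds s = trans (≡.sym (length-∑ (allFin (suc s)))) (length-tabulate (λ i → i))

votes≤seeds : ∀ {L s} (A : Algorithm n q L s) G t → votes A G t ≤ suc s
votes≤seeds {s = s} A G t = ≤-trans (∑-mono (allFin (suc s)) (λ r → 𝟙-≤1 (sameGraph? (A t r) G)))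
  (≤-reflexive (∑-seeds s))

successCount-votes : ∀ {L s} (H : ConstraintGraph q) (A : Algorithm n q L s) G →
                     successCount H A G ≡ ∑ (tuples (Ω H G) L) (votes A G)
successCount-votes {L = L} {s} H A G = trans
  (length-filter-∑ (λ p → sameGraph? (A (proj₁ p) (proj₂ p)) G)
    (cartesianProduct (tuples (Ω H G) L) (allFin (suc s))))
  (∑-cartesianProduct (tuples (Ω H G) L) (allFin (suc s)) _)

module _ {L s : ℕ} (A : Algorithm n q L s) {I : Set} (is : List I) (G : I → Graph n)
  (disjoint : ∀ X → ∑ is (λ i → 𝟙 (sameGraph? X (G i))) ≤ 1) (D : List (Colour n q)) where

  -- The tuples over `D` do not depend on `i`, so the sums can be exchanged; for a fixed tuple and
  -- seed the single output matches at most one `G i`.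
  total-votes : ∑ is (λ i → ∑ (tuples D L) (votes A (G i))) ≤ length D ^ L * suc s
  total-votes = begin
    ∑ is (λ i → ∑ (tuples D L) (votes A (G i)))
      ≡⟨ ∑-swap is (tuples D L) (λ i → votes A (G i)) ⟩
    ∑ (tuples D L) (λ t → ∑ is (λ i → votes A (G i) t))
      ≡⟨ ∑-cong (tuples D L) (λ t → ∑-swap is (allFin (suc s)) (λ i r → 𝟙 (sameGraph? (A t r) (G i)))) ⟩
    ∑ (tuples D L) (λ t → ∑ (allFin (suc s)) (λ r → ∑ is (λ i → 𝟙 (sameGraph? (A t r) (G i)))))
      ≤⟨ ∑-mono (tuples D L) (λ t → ∑-mono (allFin (suc s)) (λ r → disjoint (A t r))) ⟩
    ∑ (tuples D L) (λ _ → ∑ (allFin (suc s)) (λ _ → 1))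
      ≡⟨ ∑-const (tuples D L) _ ⟩
    length (tuples D L) * ∑ (allFin (suc s)) (λ _ → 1)
      ≡⟨ cong₂ _*_ (length-tuples D L) (∑-seeds s) ⟩
    length D ^ L * suc s ∎
    where open ≤-Reasoning

  hard-instance : 0 < length is → ∃ λ i → length is * ∑ (tuples D L) (votes A (G i)) ≤ length D ^ L * suc s
  hard-instance 0<is with below-average is 0<is (λ i → ∑ (tuples D L) (votes A (G i)))
  ... | i , le = i , ≤-trans le total-votes

-- The success probability is at most `1 / N` from tuples lying wholly in `D`, plus `L / (c * N)`
-- from the union bound over samples in `C`. Multiplying by `c * N` gives `c + L`.
success-bound : ∀ {L s} (H : ConstraintGraph q) (A : Algorithm n q L s) G {D C : List (Colour n q)} N c →
                (∀ f → ∑ (Ω H G) f ≡ ∑ D f + ∑ C f) → c * N * length C ≤ length D →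
                N * ∑ (tuples D L) (votes A G) ≤ length D ^ L * suc s →
                c * N * successCount H A G ≤ totalCount H G L s * (c + L)
success-bound {L = L} {s} H A G {D} {C} N c split few hard = begin
  c * N * successCount H A G
    ≡⟨ cong (c * N *_) (successCount-votes H A G) ⟩
  c * N * ∑ (tuples (Ω H G) L) (votes A G)
    ≤⟨ ∑-tuples-≤ {W = Ω H G} {D} {C} (c * N) split few (suc s) L (votes A G) (votes≤seeds A G) ⟩
  c * N * S + suc s * (L * w ^ L)
    ≡⟨ cong (_+ suc s * (L * w ^ L)) (*-assoc c N S) ⟩
  c * (N * S) + suc s * (L * w ^ L)
    ≤⟨ +-monoˡ-≤ _ (*-monoʳ-≤ c (≤-trans hard (*-monoˡ-≤ (suc s) (^-monoˡ-≤ L (length-≤-split {W = Ω H G} {D} {C} split))))) ⟩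
  c * (w ^ L * suc s) + suc s * (L * w ^ L)
    ≡⟨ collect (w ^ L) (suc s) L c ⟩
  w ^ L * suc s * (c + L) ∎
  where
  open ≤-Reasoning
  w = length (Ω H G)
  S = ∑ (tuples D L) (votes A G)
  collect : ∀ v k L c → c * (v * k) + k * (L * v) ≡ v * k * (c + L)
  collect = solve-∀

-- The constraint graph

-- Kinds 0 and 1 form the hard-core graph, kinds 2, 3, 4 a triangle attached to it by the edge 1 — 2; the graph is
-- blown up to one colour of kind 0, one of kind 1 and four of each other kind.
Kind : Set
Kind = Fin 5

kadj : Kind → Kind → Bool
kadj i j = lookup (lookup table i) j
  where
  table : Vec (Vec Bool 5) 5
  table = (true  ∷ true  ∷ false ∷ false ∷ false ∷ [])
        ∷ (true  ∷ false ∷ true  ∷ false ∷ false ∷ [])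
        ∷ (false ∷ true  ∷ false ∷ true  ∷ true  ∷ [])
        ∷ (false ∷ false ∷ true  ∷ false ∷ true  ∷ [])
        ∷ (false ∷ false ∷ true  ∷ true  ∷ false ∷ [])
        ∷ []

kind : Fin 14 → Kind
kind = lookup (0F ∷ 1F ∷ 2F ∷ 2F ∷ 2F ∷ 2F ∷ 3F ∷ 3F ∷ 3F ∷ 3F ∷ 4F ∷ 4F ∷ 4F ∷ 4F ∷ [])

kadj-sym : ∀ i j → kadj i j ≡ kadj j i
kadj-sym = from-yes (all? λ i → all? λ j → kadj i j Bool.≟ kadj j i)

H₁₄ : ConstraintGraph 14
H₁₄ = record
  { hadj      = λ c d → kadj (kind c) (kind d)
  ; hsym      = λ c d → kadj-sym (kind c) (kind d)
  ; nonempty  = 0F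
  ; connected = λ c d → reach (walk (kind c) (kind d))
  }
  where
  rep : Kind → Fin 14
  rep = lookup (0F ∷ 1F ∷ 2F ∷ 6F ∷ # 10 ∷ [])
  kind-rep : ∀ k → kind (rep k) ≡ k
  kind-rep = from-yes (all? λ k → kind (rep k) Fin.≟ k)
  -- Kinds 0 and 3 are at distance three. Asking for walks of length exactly three treats all pairs
  -- uniformly, including distinct colours of one kind.
  walk : ∀ i j → ∃ λ k → ∃ λ l → T (kadj i k) × T (kadj k l) × T (kadj l j)
  walk = from-yes (all? λ i → all? λ j → any? λ k → any? λ l → T? (kadj i k) ×-dec T? (kadj k l) ×-dec T? (kadj l j))
  reach : ∀ {c d} → (∃ λ k → ∃ λ l → T (kadj (kind c) k) × T (kadj k l) × T (kadj l (kind d))) →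
          Reach (λ c d → kadj (kind c) (kind d)) c d
  reach {c} {d} (k , l , ck , kl , ld) =
    step {k = rep k} (subst (λ x → T (kadj (kind c) x)) (≡.sym (kind-rep k)) ck)
      (step {k = rep l} (subst₂ (λ x y → T (kadj x y)) (≡.sym (kind-rep k)) (≡.sym (kind-rep l)) kl)
        (step {k = d} (subst (λ x → T (kadj x (kind d))) (≡.sym (kind-rep l)) ld) here))

H₁₄-identifiable : Identifiable H₁₄
H₁₄-identifiable = HardCore.identifiable H₁₄ 0F 1F tt tt (λ ())

tripartite : Kind → Bool
tripartite = lookup (false ∷ false ∷ true ∷ true ∷ true ∷ [])

-- The edge between kinds 1 and 2 joins the two halves of H₁₄ and lies in no triangle.
triangle : ∀ x y z → T (kadj x y) → T (kadj x z) → T (kadj y z) →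
           tripartite x ≡ tripartite y × tripartite x ≡ tripartite z
triangle = from-yes (all? λ x → all? λ y → all? λ z → T? (kadj x y) →-dec (T? (kadj x z) →-dec (T? (kadj y z) →-dec
  ((tripartite x Bool.≟ tripartite y) ×-dec (tripartite x Bool.≟ tripartite z)))))

-- Two triangles sharing the edge `x y` in a complete tripartite graph have their apexes in the same
-- class. The hypothesis on `w` excludes the hard-core half, where the loop breaks this.
rigid : ∀ w x y z → T (tripartite w) → T (kadj w x) → T (kadj w y) → T (kadj x y) → T (kadj x z) → T (kadj y z) → w ≡ z
rigid = from-yes (all? λ w → all? λ x → all? λ y → all? λ z →
  T? (tripartite w) →-dec (T? (kadj w x) →-dec (T? (kadj w y) →-dec (T? (kadj x y) →-dec (T? (kadj x z) →-dec
    (T? (kadj y z) →-dec (w Fin.≟ z)))))))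

-- Squares of paths with chords

-- Indexed by the distance of two vertices; the Boolean decides whether vertices at distance 4 are joined.
linked : ℕ → Bool → Bool
linked 1 _ = true
linked 2 _ = true
linked 4 b = b
linked _ _ = false

-- `β k` governs the chord from `k` to `k + 4`; indexing by the smaller endpoint makes adjacency
-- symmetric.
chorded : ∀ n → (ℕ → Bool) → Graph n
chorded n β = record
  { adj    = λ v w → linked ∣ toℕ v - toℕ w ∣ (β (toℕ v ⊓ toℕ w))
  ; sym    = λ v w → cong₂ (λ d k → linked d (β k)) (∣-∣-comm (toℕ v) (toℕ w)) (⊓-comm (toℕ v) (toℕ w))
  ; irrefl = λ v → cong (λ d → linked d (β (toℕ v ⊓ toℕ v))) (∣n-n∣≡0 (toℕ v))
  }

-- By symmetry the smaller vertex may come first, and then the difference is 1, 2 or 4.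
linked-elim : ∀ (P : ℕ → ℕ → Set) → (∀ {j k} → P j k → P k j) →
              (∀ j → P j (1 + j)) → (∀ j → P j (2 + j)) → (∀ j → P j (4 + j)) →
              ∀ j k b → T (linked ∣ j - k ∣ b) → P j k
linked-elim P P-sym P₁ P₂ P₄ j k b jk =
  [ (λ j≤k → upward j≤k jk)
  , (λ k≤j → P-sym (upward k≤j (subst (λ d → T (linked d b)) (∣-∣-comm j k) jk)))
  ]′ (≤-total j k)
  where
  ahead : ∀ {j} d → T (linked d b) → P j (d + j)
  ahead 1 _ = P₁ _
  ahead 2 _ = P₂ _
  ahead 4 _ = P₄ _
  upward : ∀ {j k} → j ≤ k → T (linked ∣ j - k ∣ b) → P j k
  upward {j} {k} j≤k jk = subst (P j) (m∸n+n≡m j≤k)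
    (ahead (k ∸ j) (subst (λ d → T (linked d b)) (m≤n⇒∣m-n∣≡n∸m j≤k) jk))

chorded-degree : ∀ n β → InFamily n 7 (chorded n β)
chorded-degree n β v = ≤-trans
  (length-filter-allFin (λ w → T? (adj (chorded n β) v w)) (around (toℕ v))
    -- Carrying both memberships makes the predicate symmetric, as `linked-elim` demands.
    (λ w vw → proj₁ (linked-elim (λ j k → k ∈ around j × j ∈ around k) (λ (p , r) → r , p)
      (λ j → here refl , there (there (there (here refl))))
      (λ j → there (here refl) , there (there (there (there (here refl)))))
      (λ j → there (there (here refl)) , there (there (there (there (there (here refl))))))
      (toℕ v) (toℕ w) _ vw)))
  (n≤1+n 6)
  where
  -- Six candidates bound the degree by 6. Near 0 truncated subtraction may repeat entries or list
  -- `k` itself, which does no harm to an upper bound.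
  around : ℕ → List ℕ
  around k = 1 + k ∷ 2 + k ∷ 4 + k ∷ k ∸ 1 ∷ k ∸ 2 ∷ k ∸ 4 ∷ []

all-chords : ∀ n → Graph n
all-chords n = chorded n (λ _ → true)

chorded⊆all-chords : ∀ β v w → T (adj (chorded n β) v w) → T (adj (all-chords n) v w)
chorded⊆all-chords β v w = linked-mono ∣ toℕ v - toℕ w ∣
  where
  linked-mono : ∀ d {b} → T (linked d b) → T (linked d true)
  linked-mono 1 _ = tt
  linked-mono 2 _ = tt
  linked-mono 4 _ = tt

residue : ℕ → Kind
residue 0 = 2F
residue 1 = 3F
residue 2 = 4F
residue (suc (suc (suc k))) = residue k

-- None of the gaps 1, 2, 4 is divisible by 3, so the ends of every edge fall in different
-- tripartite classes. Gap 4 reuses `next` because 4 is 1 modulo 3.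
residue-colours : ∀ σ → (∀ i → kind (σ i) ≡ residue (toℕ i)) → IsHColouring H₁₄ (all-chords n) σ
residue-colours σ eq v w vw = subst₂ (λ c d → T (kadj c d)) (≡.sym (eq v)) (≡.sym (eq w))
  (linked-elim (λ j k → T (kadj (residue j) (residue k))) (λ {j} {k} → subst T (kadj-sym (residue j) (residue k)))
    next next₂ next (toℕ v) (toℕ w) _ vw)
  where
  next : ∀ j → T (kadj (residue j) (residue (1 + j)))
  next 0 = tt
  next 1 = tt
  next 2 = tt
  next (suc (suc (suc j))) = next j
  next₂ : ∀ j → T (kadj (residue j) (residue (2 + j)))
  next₂ 0 = tt
  next₂ 1 = tt
  next₂ 2 = tt
  next₂ (suc (suc (suc j))) = next₂ j

residue-count : ∀ k → ∑ (allFin 14) (λ c → 𝟙 (kind c Fin.≟ residue k)) ≡ 4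
residue-count 0 = refl
residue-count 1 = refl
residue-count 2 = refl
residue-count (suc (suc (suc k))) = residue-count k

4^n≤length-Ω : ∀ n → 4 ^ n ≤ length (Ω H₁₄ (all-chords n))
4^n≤length-Ω n = k^n≤length-Ω H₁₄ (all-chords n) (λ i c → kind c Fin.≟ residue (toℕ i)) 4
  (λ i → residue-count (toℕ i)) residue-colours

-- Structure of the colourings of a chorded graph.

module Dichotomy {n : ℕ} (3≤n : 3 ≤ n) (β : ℕ → Bool) (σ : Colour n 14)
  (col : IsHColouring H₁₄ (chorded n β) σ) where

  0<n : 0 < n
  0<n = ≤-trans (s≤s z≤n) 3≤n

  -- Indexing by naturals allows arithmetic on positions along the path; the irrelevant bound keeps
  -- values independent of its proof.
  κ : ∀ k → .(k < n) → Kind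
  κ k k<n = kind (σ (fromℕ< k<n))

  κ-toℕ : ∀ v → κ (toℕ v) (toℕ<n v) ≡ kind (σ v)
  κ-toℕ v = cong (kind ∘ σ) (fromℕ<-toℕ v (toℕ<n v))

  -- Taking `linked` at `false` leaves only gaps 1 and 2, the edges present for every `β`.
  κ-adj : ∀ j k .(j<n : j < n) .(k<n : k < n) → T (linked ∣ j - k ∣ false) → T (kadj (κ j j<n) (κ k k<n))
  κ-adj j k j<n k<n jk = col (fromℕ< j<n) (fromℕ< k<n)
    (subst₂ (λ j′ k′ → T (linked ∣ j′ - k′ ∣ (β (j′ ⊓ k′)))) (≡.sym (toℕ-fromℕ< j<n)) (≡.sym (toℕ-fromℕ< k<n))
      (anyChord ∣ j - k ∣ jk))
    where
    anyChord : ∀ d {b} → T (linked d false) → T (linked d b)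
    anyChord 1 _ = tt
    anyChord 2 _ = tt
    anyChord 4 ()

  lower : ∀ d {k} → d + k < n → k < n
  lower d {k} = ≤-trans (s≤s (m≤n+m k d))

  dist : ∀ d k → ∣ k - d + k ∣ ≡ d
  dist d k = trans (cong ∣ k -_∣ (+-comm d k)) (∣m-m+n∣≡n k d)

  κ-adj₁ : ∀ k .(k<n : k < n) .(1+k<n : 1 + k < n) → T (kadj (κ k k<n) (κ (1 + k) 1+k<n))
  κ-adj₁ k p r = κ-adj k (1 + k) p r (subst (λ d → T (linked d false)) (≡.sym (dist 1 k)) tt)

  κ-adj₂ : ∀ k .(k<n : k < n) .(2+k<n : 2 + k < n) → T (kadj (κ k k<n) (κ (2 + k) 2+k<n))
  κ-adj₂ k p r = κ-adj k (2 + k) p r (subst (λ d → T (linked d false)) (≡.sym (dist 2 k)) tt)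

  κ-triangle : ∀ k .(p₀ : k < n) .(p₁ : 1 + k < n) .(p₂ : 2 + k < n) →
               tripartite (κ k p₀) ≡ tripartite (κ (1 + k) p₁) × tripartite (κ k p₀) ≡ tripartite (κ (2 + k) p₂)
  κ-triangle k p₀ p₁ p₂ = triangle (κ k p₀) (κ (1 + k) p₁) (κ (2 + k) p₂)
    (κ-adj₁ k p₀ p₁) (κ-adj₂ k p₀ p₂) (κ-adj₁ (1 + k) p₁ p₂)

  -- Three consecutive vertices form a triangle, which cannot cross between the halves, so the half
  -- propagates in steps of two. For vertex 1 the triangle on 0, 1, 2 is used, hence `3≤n`.
  same-half : ∀ k .(p : k < n) → tripartite (κ k p) ≡ tripartite (κ 0 0<n)
  same-half zero p = refl
  same-half (suc zero) p = ≡.sym (proj₁ (κ-triangle 0 0<n p 3≤n))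
  same-half (suc (suc k)) p = trans
    (≡.sym (proj₂ (κ-triangle k (lower 2 p) (lower 1 p) p)))
    (same-half k (lower 2 p))

  in-core : tripartite (κ 0 0<n) ≡ false → ∀ v → tripartite (kind (σ v)) ≡ false
  in-core eq v = trans (cong tripartite (≡.sym (κ-toℕ v))) (trans (same-half (toℕ v) (toℕ<n v)) eq)

  module _ (eq : tripartite (κ 0 0<n) ≡ true) where

    κ-tripartite : ∀ k .(p : k < n) → T (tripartite (κ k p))
    κ-tripartite k p = subst T (≡.sym (trans (same-half k p) eq)) tt

    -- The triangles starting at `k` and at `1 + k` share an edge, so `rigid` identifies the kinds
    -- of their apexes.
    κ-periodic : ∀ k .(p : k < n) .(r : 3 + k < n) → κ k p ≡ κ (3 + k) r
    κ-periodic k p r = rigid (κ k p) (κ (1 + k) (lower 2 r)) (κ (2 + k) (lower 1 r)) (κ (3 + k) r) (κ-tripartite k p)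
      (κ-adj₁ k p (lower 2 r)) (κ-adj₂ k p (lower 1 r)) (κ-adj₁ (1 + k) (lower 2 r) (lower 1 r))
      (κ-adj₂ (1 + k) (lower 2 r) r) (κ-adj₁ (2 + k) (lower 1 r) r)

    -- By periodicity `4 + k` has the kind of `1 + k`, a neighbour of `k`. Hence a chord excludes no
    -- tripartite colouring.
    κ-adj₄ : ∀ k .(p : k < n) .(r : 4 + k < n) → T (kadj (κ k p) (κ (4 + k) r))
    κ-adj₄ k p r = subst (λ z → T (kadj (κ k p) z)) (κ-periodic (1 + k) (lower 3 r) r) (κ-adj₁ k p (lower 3 r))

    colours-all-chords : IsHColouring H₁₄ (all-chords n) σ
    colours-all-chords v w vw = subst₂ (λ c d → T (kadj c d)) (κ-toℕ v) (κ-toℕ w)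
      (linked-elim (λ j k → .(p : j < n) .(r : k < n) → T (kadj (κ j p) (κ k r)))
        (λ {j} {k} jk r p → subst T (kadj-sym (κ j p) (κ k r)) (jk p r))
        κ-adj₁ κ-adj₂ κ-adj₄ (toℕ v) (toℕ w) true vw (toℕ<n v) (toℕ<n w))

  dichotomy : ¬ IsHColouring H₁₄ (all-chords n) σ → ∀ v → tripartite (kind (σ v)) ≡ false
  dichotomy ¬col with tripartite (κ 0 0<n) in eq
  ... | true  = ⊥-elim (¬col (colours-all-chords eq))
  ... | false = in-core eq

-- Decoding chords and counting exceptional colourings.

bit : Vec Bool m → ℕ → Bool
-- The default is harmless: on `4 + m` vertices the smaller endpoint of a chord is below `m`.
bit []      _       = false
bit (b ∷ β) zero    = b
bit (b ∷ β) (suc k) = bit β k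

bit-lookup : ∀ (β : Vec Bool m) i → bit β (toℕ i) ≡ lookup β i
bit-lookup (b ∷ β) zero    = refl
bit-lookup (b ∷ β) (suc i) = bit-lookup β i

chords : Graph (4 + m) → Vec Bool m
chords {m} G = tabulate λ i → adj G (inject≤ i (m≤n+m m 4)) (suc (suc (suc (suc i))))

-- Vertices `i` and `4 + i` are at distance 4 with minimum `i`, so their adjacency is bit `i` of
-- `β`. A graph therefore equals at most one chorded graph.
chords-chorded : ∀ (G : Graph (4 + m)) β → SameGraph G (chorded (4 + m) (bit β)) → β ≡ chords G
chords-chorded {m} G β same = trans (≡.sym (tabulate∘lookup β)) (tabulate-cong λ i → begin
  lookup β i
    ≡⟨ bit-lookup β i ⟨
  bit β (toℕ i)
    ≡⟨ cong₂ (λ d k → linked d (bit β k)) (trans (cong ∣ toℕ i -_∣ (+-comm 4 (toℕ i))) (∣m-m+n∣≡n (toℕ i) 4)) (m≤n⇒m⊓n≡m (m≤n+m (toℕ i) 4)) ⟨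
  linked ∣ toℕ i - 4 + toℕ i ∣ (bit β (toℕ i ⊓ (4 + toℕ i)))
    ≡⟨ cong (λ k → linked ∣ k - 4 + toℕ i ∣ (bit β (k ⊓ (4 + toℕ i)))) (toℕ-inject≤ i (m≤n+m m 4)) ⟨
  adj (chorded (4 + m) (bit β)) (inject≤ i (m≤n+m m 4)) (suc (suc (suc (suc i))))
    ≡⟨ same _ _ ⟨
  adj G (inject≤ i (m≤n+m m 4)) (suc (suc (suc (suc i)))) ∎)
  where open ≡.≡-Reasoning

exceptional : ∀ n → (ℕ → Bool) → List (Colour n 14)
exceptional n β = filter (λ σ → isHColouring? H₁₄ (chorded n β) σ ×-dec ¬? (isHColouring? H₁₄ (all-chords n) σ)) (allMaps n 14)

-- `all-chords` has the most edges, so its colourings are valid for every `β`: they form the common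
-- set.
Ω-split : ∀ n β f → ∑ (Ω H₁₄ (chorded n β)) f ≡ ∑ (Ω H₁₄ (all-chords n)) f + ∑ (exceptional n β) f
Ω-split n β = ∑-filter-split (isHColouring? H₁₄ (chorded n β)) (isHColouring? H₁₄ (all-chords n))
  (λ σ col v w vw → col v w (chorded⊆all-chords β v w vw)) (allMaps n 14)

-- By the dichotomy an exceptional colouring uses only kinds 0 and 1, which have one colour each:
-- two choices per vertex.
length-exceptional : ∀ {n} → 3 ≤ n → ∀ β → length (exceptional n β) ≤ 2 ^ n
length-exceptional {n} 3≤n β = begin
  length (exceptional n β)                    ≡⟨ length-filter-∑ exc? (allMaps n 14) ⟩
  ∑ (allMaps n 14) (λ σ → 𝟙 (exc? σ))         ≤⟨ ∑-mono (allMaps n 14) (λ σ → 𝟙-mono (exc? σ) (core? σ)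
                                                   (λ (col , ¬col) → Dichotomy.dichotomy 3≤n β σ col ¬col)) ⟩
  ∑ (allMaps n 14) (λ σ → 𝟙 (core? σ))        ≡⟨ count-product n (λ _ c → tripartite (kind c) Bool.≟ false) 2 (λ _ → refl) ⟩
  2 ^ n                                       ∎
  where
  open ≤-Reasoning
  exc? = λ σ → isHColouring? H₁₄ (chorded n β) σ ×-dec ¬? (isHColouring? H₁₄ (all-chords n) σ)
  core? : (σ : Colour n 14) → Dec (∀ v → tripartite (kind (σ v)) ≡ false)
  core? σ = all? λ v → tripartite (kind (σ v)) Bool.≟ false

-- Four colours per tripartite class against two in the core yield the ratio `4 ^ n / 2 ^ n`.
few-exceptional : ∀ {n} → 3 ≤ n → ∀ β → 2 ^ n * length (exceptional n β) ≤ length (Ω H₁₄ (all-chords n))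
few-exceptional {n} 3≤n β = begin
  2 ^ n * length (exceptional n β)   ≤⟨ *-monoʳ-≤ (2 ^ n) (length-exceptional 3≤n β) ⟩
  2 ^ n * 2 ^ n                      ≡⟨ ^-distribʳ-* n 2 2 ⟨
  4 ^ n                              ≤⟨ 4^n≤length-Ω n ⟩
  length (Ω H₁₄ (all-chords n))      ∎
  where
  open ≤-Reasoning

-- The exponential lower bound on samples.

chorded-disjoint : 4 + m ≡ n → (X : Graph n) →
                   ∑ (tuples (false ∷ true ∷ []) m) (λ β → 𝟙 (sameGraph? X (chorded n (bit β)))) ≤ 1
chorded-disjoint {m} {n} refl X = ∑-boolVecs-≤1 m _ (chords X)
  (λ β → 𝟙-≤1 (sameGraph? X (chorded n (bit β))))
  (λ β β≢ → 𝟙-no (sameGraph? X (chorded n (bit β))) (β≢ ∘ chords-chorded X β))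

-- The hard `β` depends on `A` and comes from averaging over `2 ^ (n - 4)` graphs. The factor 16
-- turns that number into `2 ^ n`, the ratio in `few-exceptional`.
success-chorded : ∀ {L s} → 4 ≤ n → (A : Algorithm n 14 L s) → ∃ λ β →
                  2 ^ n * successCount H₁₄ A (chorded n β) ≤ totalCount H₁₄ (chorded n β) L s * (16 + L)
success-chorded {n} {L} {s} 4≤n A with hard-instance A (tuples (false ∷ true ∷ []) (n ∸ 4)) (λ β → chorded n (bit β))
  (chorded-disjoint (m+[n∸m]≡n 4≤n)) (Ω H₁₄ (all-chords n))
  (subst (0 <_) (≡.sym (length-tuples (false ∷ true ∷ []) (n ∸ 4))) (m^n>0 2 (n ∸ 4)))
... | β , hard = bit β , subst (λ k → k * successCount H₁₄ A G ≤ totalCount H₁₄ G L s * (16 + L)) 16*N≡2^n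
  (success-bound H₁₄ A G {D} {C} N 16 (Ω-split n (bit β))
    (subst (λ k → k * length C ≤ length D) (≡.sym 16*N≡2^n) (few-exceptional (≤-trans (n≤1+n 3) 4≤n) (bit β))) hard)
  where
  G = chorded n (bit β)
  D = Ω H₁₄ (all-chords n)
  C = exceptional n (bit β)
  N = length (tuples (false ∷ true ∷ []) (n ∸ 4))
  16*N≡2^n : 16 * N ≡ 2 ^ n
  16*N≡2^n = trans (cong (16 *_) (length-tuples (false ∷ true ∷ []) (n ∸ 4)))
    (trans (≡.sym (^-distribˡ-+-* 2 4 (n ∸ 4))) (cong (2 ^_) (m+[n∸m]≡n 4≤n)))

-- With fewer than `(9/8) ^ n` samples the hypothesis would give `128 ^ n < 17 * 81 ^ n`, where 128
-- = 2 * 8 * 8, 81 = 9 * 9 and 17 = 16 + 1.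
many-samples : ∀ n L → 8 ≤ n → 2 ^ n * 8 ^ n ≤ (16 + L) * 9 ^ n → 9 ^ n ≤ L * 8 ^ n
many-samples n L 8≤n bound = ≮⇒≥ λ few → <-irrefl refl (begin-strict
  128 ^ n                              ≡⟨ trans (^-distribʳ-* n 16 8) (cong (_* 8 ^ n) (^-distribʳ-* n 2 8)) ⟩
  2 ^ n * 8 ^ n * 8 ^ n                ≤⟨ *-monoˡ-≤ (8 ^ n) bound ⟩
  (16 + L) * 9 ^ n * 8 ^ n             ≡⟨ expand L (9 ^ n) (8 ^ n) ⟩
  16 * (9 ^ n * 8 ^ n) + 9 ^ n * (L * 8 ^ n)
    <⟨ +-mono-≤-< (*-monoʳ-≤ 16 (*-monoʳ-≤ (9 ^ n) (^-monoˡ-≤ n (n≤1+n 8)))) (*-monoʳ-< (9 ^ n) {{m^n≢0 9 n}} few) ⟩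
  16 * (9 ^ n * 9 ^ n) + 9 ^ n * 9 ^ n ≡⟨ gather (9 ^ n * 9 ^ n) ⟩
  17 * (9 ^ n * 9 ^ n)                 ≡⟨ cong (17 *_) (^-distribʳ-* n 9 9) ⟨
  -- The inequality is computed at exponent 8 and carried upwards by `*-^-mono`; this is where `8≤n`
  -- enters.
  17 * 81 ^ n                          ≤⟨ subst (λ k → 17 * 81 ^ k ≤ 128 ^ k) (m∸n+n≡m 8≤n)
                                            (*-^-mono 17 (m≤m+n 81 47) 8 (toWitness {a? = 17 * 81 ^ 8 ≤? 128 ^ 8} tt) (n ∸ 8)) ⟩
  128 ^ n                              ∎)
  where
  open ≤-Reasoning
  expand : ∀ L x y → (16 + L) * x * y ≡ 16 * (x * y) + x * (L * y)
  expand = solve-∀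
  gather : ∀ x → 16 * x + x ≡ 17 * x
  gather = solve-∀

totalCount≢0 : ∀ (H : ConstraintGraph q) (G : Graph n) L s → 1 ≤ length (Ω H G) → NonZero (totalCount H G L s)
totalCount≢0 H G L s 1≤Ω = m*n≢0 (length (Ω H G) ^ L) (suc s) {{m^n≢0 (length (Ω H G)) L {{>-nonZero 1≤Ω}}}}

learning-bound : ∀ {L s} → 4 ≤ n → (A : Algorithm n 14 L s) → ∀ a b → SucceedsWithProb≥ H₁₄ 7 A a b →
                 2 ^ n * b ^ n ≤ (16 + L) * a ^ n
learning-bound {n} {L} {s} 4≤n A a b succeeds = conclude (success-chorded 4≤n A)
  where
  conclude : (∃ λ β → 2 ^ n * successCount H₁₄ A (chorded n β) ≤ totalCount H₁₄ (chorded n β) L s * (16 + L)) →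
             2 ^ n * b ^ n ≤ (16 + L) * a ^ n
  conclude (β , bound) = cancel-total (totalCount H₁₄ (chorded n β) L s)
    {{totalCount≢0 H₁₄ (chorded n β) L s (HardCore.1≤length-Ω H₁₄ 0F 1F tt tt (λ ()) (chorded n β))}}
    (successCount H₁₄ A (chorded n β)) (2 ^ n) (b ^ n) (a ^ n) (16 + L)
    -- Since colour `0F` has a loop, the constant colouring shows colourability.
    (succeeds (chorded n β) (chorded-degree n β) ((λ _ → 0F) , λ _ _ _ → tt)) bound

theorem2 : Σ ℕ λ q → Σ (ConstraintGraph q) λ H → Identifiable H ×
    (Σ ℕ λ a → Σ ℕ λ b → 0 < b × b < a ×
    (∀ (n : ℕ) → 8 ≤ n → ∀ (L s : ℕ) (A : Algorithm n q L s) →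
    OutputsInFamily 7 A → SucceedsWithProb≥ H 7 A a b →
    a ^ n ≤ L * b ^ n))
-- The constant is c = log (9/8), so exp(-cn) is `(8/9) ^ n`.
theorem2 = 14 , H₁₄ , H₁₄-identifiable , 9 , 8 , s≤s z≤n , ≤-refl ,
  λ n 8≤n L s A _ succeeds → many-samples n L 8≤n (learning-bound (≤-trans (m≤m+n 4 4) 8≤n) A 9 8 succeeds)
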